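{- Let $k,n \geq 1$ be integers and let $H_{k,n}$ be the (simple, unweighted) hexagonal grid graph. Then $$\det A(H_{k,n}) = (-1)^{kn+n+k}\left[\binom{n+k}{n}\right]^2 .$$
   Context: $A(G)$ denotes the usual adjacency matrix of a finite simple graph $G$ (entry $1$ for adjacent pairs of vertices, $0$ otherwise, zero diagonal). Hexagonal grid: for integers $p,q\ge 1$ the simple graph $H_{p,q}$ is defined as follows. Take the disjoint union $G$ of $q+1$ simple paths: for each $i\in\{1,\dots,q\}$ the path $P^i = v^i_1 v^i_2 \dots v^i_{2p+1} v^i_{2p+2}$ on $2p+2$ vertices, and the path $P^{q+1} = v^{q+1}_2 v^{q+1}_3\dots v^{q+1}_{2p+1}$ on $2p$ vertices. Then $V(H_{p,q})=V(G)$, and the edges of $H_{p,q}$ are exactly: all edges of $G$; the edges $v^{i+1}_2 v^i_1$ for $i\in\{1,\dots,q\}$; and the edges $v^{i+1}_{2j+1}v^i_{2j+2}$ for $j\in\{1,\dots,p\}$, $i\in\{1,\dots,q\}$. Thus $H_{k,n}$ is obtained with $p=k$, $q=n$. -}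

module Defs where

open import Data.Bool.Base using (if_then_else_)
open import Data.Fin.Base using (Fin; zero; suc; toℕ; punchIn)
open import Data.Fin.Properties using (any?; +↔⊎; *↔×)
open import Data.Integer.Base as ℤ using (ℤ; 0ℤ; 1ℤ; -1ℤ)
open import Data.Integer.Properties using (+-0-commutativeMonoid)
open import Data.Nat.Base using (ℕ; zero; suc; _+_; _*_)
open import Data.Nat.Properties using (_≟_; 1+n≢n)
open import Data.Product.Base using (∃-syntax; _×_; _,_)
open import Data.Sum.Base using (_⊎_; inj₁; inj₂; swap)
open import Data.Sum.Function.Propositional using (_⊎-↔_)
open import Function.Bundles using (_↔_; Inverse)
open import Function.Construct.Composition using (_↔-∘_)
open import Function.Construct.Identity using (↔-id)
open import Relation.Binary.Definitions using (Symmetric; Decidable)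
open import Relation.Binary.PropositionalEquality.Core using (_≡_; sym)
open import Relation.Nullary.Decidable.Core using (does; _×-dec_; _⊎-dec_)
open import Relation.Nullary.Negation.Core using (¬_)

open import Algebra.Properties.CommutativeMonoid.Sum +-0-commutativeMonoid
  using (sum)

Matrix : ℕ → Set
Matrix n = Fin n → Fin n → ℤ

-- Cofactor expansion along the first row.
det : ∀ {n} → Matrix n → ℤ
det {zero}  M = 1ℤ
det {suc n} M =
  sum λ j → -1ℤ ℤ.^ toℕ j ℤ.* M zero j ℤ.* det λ r c → M (suc r) (punchIn j c)

record SimpleGraph : Set₁ where
  infix 4 _~_ _~?_
  field
    V      : Set
    _~_    : V → V → Set
    _~?_   : Decidable _~_
    ~-sym  : Symmetric _~_
    ~-irr  : ∀ v → ¬ (v ~ v)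

-- A finite graph on N vertices is given with an enumeration of its
-- vertices, which orders the rows and columns (in the same way).
A : (G : SimpleGraph) → ∀ {N} → Fin N ↔ SimpleGraph.V G → Matrix N
A G e r c = if does (to r ~? to c) then 1ℤ else 0ℤ
  where
  open SimpleGraph G
  open Inverse e using (to)

module Hexagonal (p q : ℕ) where

  -- The first summand carries the paths P¹, …, P^q on 2p+2 vertices,
  -- the second the path P^{q+1} on 2p vertices.
  Vertex : Set
  Vertex = (Fin q × Fin (2 * p + 2)) ⊎ Fin (2 * p)

  -- The superscript i and the subscript j of the vertex v^i_j; the
  -- subscripts on the last path start from 2.
  label : Vertex → ℕ × ℕ
  label (inj₁ (i , j)) = suc (toℕ i) , suc (toℕ j)
  label (inj₂ j)       = suc q , 2 + toℕ j

  -- Edges, each in one orientation, between labels: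
  --   v^i_j          v^i_{j+1},
  --   v^{i+1}_2      v^i_1,
  --   v^{i+1}_{2j+1} v^i_{2j+2}  with 1 ≤ j ≤ p, where j = suc (toℕ t).
  -- The remaining bounds hold because both labels belong to vertices.
  Edge : ℕ × ℕ → ℕ × ℕ → Set
  Edge (a , b) (c , d) =
      (a ≡ c × d ≡ suc b)
    ⊎ (a ≡ suc c × b ≡ 2 × d ≡ 1)
    ⊎ (a ≡ suc c × ∃[ t ] let j = suc (toℕ {p} t) in
                            b ≡ 2 * j + 1 × d ≡ 2 * j + 2)

  edge? : Decidable Edge
  edge? (a , b) (c , d) =
          (a ≟ c ×-dec d ≟ suc b)
    ⊎-dec (a ≟ suc c ×-dec b ≟ 2 ×-dec d ≟ 1)
    ⊎-dec (a ≟ suc c ×-dec any? λ t → let j = suc (toℕ {p} t) in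
                             b ≟ 2 * j + 1 ×-dec d ≟ 2 * j + 2)

  edge-irr : ∀ x → ¬ Edge x x
  edge-irr x (inj₁ (_ , eq))        = 1+n≢n (sym eq)
  edge-irr x (inj₂ (inj₁ (eq , _))) = 1+n≢n (sym eq)
  edge-irr x (inj₂ (inj₂ (eq , _))) = 1+n≢n (sym eq)

  graph : SimpleGraph
  graph = record
    { V     = Vertex
    ; _~_   = λ u v → Edge (label u) (label v) ⊎ Edge (label v) (label u)
    ; _~?_  = λ u v → edge? (label u) (label v) ⊎-dec edge? (label v) (label u)
    ; ~-sym = swap
    ; ~-irr = λ { v (inj₁ e) → edge-irr (label v) e
                ; v (inj₂ e) → edge-irr (label v) e }
    }

  -- Path by path, each in increasing order of subscripts.
  enumeration : Fin (q * (2 * p + 2) + 2 * p) ↔ Vertex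
  enumeration = (*↔× ⊎-↔ ↔-id _) ↔-∘ +↔⊎

H : ℕ → ℕ → SimpleGraph
H p q = Hexagonal.graph p q

{-# OPTIONS --safe #-}
module Submission where

-- The graph is bipartite, its classes being the vertices of odd and of even
-- subscript, so det A = (-1)^m (det B)² with B the m × m biadjacency matrix,
-- m = kn + n + k. On the grid {0, …, n} × {0, …, k} the matrix T = I + right +
-- down, where right and down are the shifts, is unitriangular, and B is T
-- without the row of the corner (0 , 0) and the column of the corner (n , k).
-- By Pascal's recurrence, the coefficients (-1)^(i+a) C(i+a, i) give a linear
-- relation between all columns of T outside the row of (0 , 0). It exchanges the
-- column of B at (0 , 0) for the missing one at (n , k), at the price of a factor
-- ± C(n+k, n), and the matrix that remains is unitriangular.

open import Defs
open import Data.Bool.Base using (if_then_else_)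
open import Data.Fin.Base using (Fin; zero; suc; toℕ; fromℕ<; punchIn)
open import Data.Fin.Properties using (toℕ<n; toℕ-fromℕ<; toℕ-injective)
open import Data.Integer.Base as ℤ using (ℤ; 0ℤ; 1ℤ; -1ℤ; +_)
import Data.Integer.Properties as ℤ
open import Data.Integer.Tactic.RingSolver using (solve-∀)
open import Data.List.Base
  using (List; []; _∷_; _++_; [_]; _∷ʳ_; map; length; tabulate; applyUpTo; upTo; cartesianProduct)
open import Data.List.Membership.Propositional using (_∈_)
open import Data.List.Membership.Propositional.Properties
  using ( ∈-++⁺ˡ; ∈-++⁺ʳ; ∈-++⁻; ∈-map⁺; ∈-map⁻; ∈-tabulate⁺; ∈-tabulate⁻
        ; ∈-upTo⁺; ∈-upTo⁻; ∈-cartesianProduct⁺; ∈-cartesianProduct⁻)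
open import Data.List.Membership.Propositional.Properties.WithK using (unique∧set⇒bag)
import Data.List.Properties as List
open import Data.List.Relation.Binary.BagAndSetEquality using (∼bag⇒↭)
open import Data.List.Relation.Binary.Permutation.Propositional as ↭ using (_↭_)
open import Data.List.Relation.Unary.All as All using (All; []; _∷_)
import Data.List.Relation.Unary.All.Properties as All
open import Data.List.Relation.Unary.AllPairs as AllPairs using (AllPairs; []; _∷_)
import Data.List.Relation.Unary.AllPairs.Properties as AllPairs
open import Data.List.Relation.Unary.Any using (here; there)
open import Data.List.Relation.Unary.Unique.Propositional using (Unique)
import Data.List.Relation.Unary.Unique.Propositional.Properties as Unique
open import Data.Nat.Base using (ℕ; zero; suc; _+_; _*_; _≤_; _<_; z≤n; s≤s)
open import Data.Nat.Combinatorics using (_C_; nCn≡1; nCk+nC[k+1]≡[n+1]C[k+1])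
open import Data.Nat.Properties as ℕ using (_≟_)
import Data.Nat.Tactic.RingSolver as ℕ-Solver
open import Data.Product.Base using (_×_; _,_; proj₁; proj₂; ∃-syntax)
open import Data.Product.Properties using (≡-dec; ,-injectiveˡ; ,-injectiveʳ)
open import Data.Sum.Base using (_⊎_; inj₁; inj₂; swap; [_,_]′)
open import Function.Base using (_∘_; flip; id)
open import Function.Bundles using (_↔_; Inverse; mk⇔)
open import Relation.Binary.PropositionalEquality
  using (_≡_; _≢_; refl; sym; trans; cong; cong₂; subst; setoid; module ≡-Reasoning)
open import Relation.Nullary.Decidable
  using (Dec; does; yes; no; _⊎-dec_; dec-true; dec-false; does-⇔)
open import Relation.Nullary.Negation.Core using (¬_; contradiction)

open import Algebra.Properties.CommutativeMonoid.Sum ℤ.+-0-commutativeMonoid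
  using (sum; sum-cong-≗)

open ≡-Reasoning

private
  variable
    X Y X′ Y′ : Set

-- Powers of minus one

sgn : ℕ → ℤ
sgn n = -1ℤ ℤ.^ n

sgn-square : ∀ n → sgn n ℤ.* sgn n ≡ 1ℤ
sgn-square zero    = refl
sgn-square (suc n) = trans (shuffle (sgn n)) (sgn-square n)
  where
  shuffle : ∀ s → (-1ℤ ℤ.* s) ℤ.* (-1ℤ ℤ.* s) ≡ s ℤ.* s
  shuffle = solve-∀

sgn-+ : ∀ m n → sgn (m + n) ≡ sgn m ℤ.* sgn n
sgn-+ = ℤ.^-distribˡ-+-* -1ℤ

-- Determinants as iterated contractions

-- contract f is the interior product with the covector f: a function φ on
-- lists plays the role of a (not necessarily alternating) form, and deleting
-- the entry at position i carries the sign (-1)^i.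
contract : (Y → ℤ) → (List Y → ℤ) → List Y → ℤ
contract f φ []       = 0ℤ
contract f φ (y ∷ ys) = f y ℤ.* φ ys ℤ.- contract f (φ ∘ (y ∷_)) ys

-- The first listed row is contracted outermost. The final form `φ` is left arbitrary so that a list
-- of rows can be cut in two and the later rows absorbed into `φ`.
contractAll : (X → Y → ℤ) → List X → (List Y → ℤ) → List Y → ℤ
contractAll M []       φ = φ
contractAll M (x ∷ xs) φ = contract (M x) (contractAll M xs φ)

-- With this final form, `detL` is also defined for lists of different lengths, where it is zero.
δ[] : List Y → ℤ
δ[] []      = 1ℤ
δ[] (_ ∷ _) = 0ℤ

detL : (X → Y → ℤ) → List X → List Y → ℤ
detL M xs = contractAll M xs δ[]

∑ : List X → (X → ℤ) → ℤ
∑ []       F = 0ℤ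
∑ (x ∷ xs) F = F x ℤ.+ ∑ xs F

-- A contraction evaluates its form only on lists one entry shorter than `ys`; keeping track of this
-- length is what makes `contractAll-full` work.
contract-cong : ∀ {f : Y → ℤ} {φ ψ} ys →
  (∀ zs → suc (length zs) ≡ length ys → φ zs ≡ ψ zs) →
  contract f φ ys ≡ contract f ψ ys
contract-cong []       eq = refl
contract-cong {f = f} (y ∷ ys) eq = cong₂ (λ a b → f y ℤ.* a ℤ.- b)
  (eq ys refl)
  (contract-cong ys λ zs len → eq (y ∷ zs) (cong suc len))

contract-congˡ : ∀ {f g : Y → ℤ} → (∀ y → f y ≡ g y) →
  ∀ φ ys → contract f φ ys ≡ contract g φ ys
contract-congˡ eq φ []       = refl
contract-congˡ eq φ (y ∷ ys) = cong₂ (λ a b → a ℤ.* φ ys ℤ.- b)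
  (eq y) (contract-congˡ eq (φ ∘ (y ∷_)) ys)

-- The combination of `φ` and `ψ` has the shape of `contract` unfolded at a nonempty list, with `c`
-- a value of the inner covector; nested contractions are expanded this way.
contract-linear : ∀ (f : Y → ℤ) c φ ψ ys →
  contract f (λ zs → c ℤ.* φ zs ℤ.- ψ zs) ys ≡
  c ℤ.* contract f φ ys ℤ.- contract f ψ ys
contract-linear f c φ ψ []       = zero-case c
  where
  zero-case : ∀ c → 0ℤ ≡ c ℤ.* 0ℤ ℤ.- 0ℤ
  zero-case = solve-∀
contract-linear f c φ ψ (y ∷ ys) = begin
  f y ℤ.* (c ℤ.* φ ys ℤ.- ψ ys) ℤ.- contract f (λ zs → c ℤ.* φ (y ∷ zs) ℤ.- ψ (y ∷ zs)) ys
    ≡⟨ cong (λ u → f y ℤ.* (c ℤ.* φ ys ℤ.- ψ ys) ℤ.- u) (contract-linear f c (φ ∘ (y ∷_)) (ψ ∘ (y ∷_)) ys) ⟩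
  f y ℤ.* (c ℤ.* φ ys ℤ.- ψ ys) ℤ.- (c ℤ.* contract f (φ ∘ (y ∷_)) ys ℤ.- contract f (ψ ∘ (y ∷_)) ys)
    ≡⟨ shuffle (f y) c (φ ys) (ψ ys) _ _ ⟩
  c ℤ.* (f y ℤ.* φ ys ℤ.- contract f (φ ∘ (y ∷_)) ys) ℤ.-
    (f y ℤ.* ψ ys ℤ.- contract f (ψ ∘ (y ∷_)) ys) ∎
  where
  shuffle : ∀ f c a b u v → f ℤ.* (c ℤ.* a ℤ.- b) ℤ.- (c ℤ.* u ℤ.- v) ≡
                            c ℤ.* (f ℤ.* a ℤ.- u) ℤ.- (f ℤ.* b ℤ.- v)
  shuffle = solve-∀

contract-scale : ∀ (f : Y → ℤ) c φ ys →
  contract f (λ zs → c ℤ.* φ zs) ys ≡ c ℤ.* contract f φ ys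
contract-scale f c φ []       = sym (ℤ.*-zeroʳ c)
contract-scale f c φ (y ∷ ys) = begin
  f y ℤ.* (c ℤ.* φ ys) ℤ.- contract f (λ zs → c ℤ.* φ (y ∷ zs)) ys
    ≡⟨ cong (λ u → f y ℤ.* (c ℤ.* φ ys) ℤ.- u) (contract-scale f c (φ ∘ (y ∷_)) ys) ⟩
  f y ℤ.* (c ℤ.* φ ys) ℤ.- c ℤ.* contract f (φ ∘ (y ∷_)) ys
    ≡⟨ shuffle (f y) c (φ ys) _ ⟩
  c ℤ.* (f y ℤ.* φ ys ℤ.- contract f (φ ∘ (y ∷_)) ys) ∎
  where
  shuffle : ∀ f c a u → f ℤ.* (c ℤ.* a) ℤ.- c ℤ.* u ≡ c ℤ.* (f ℤ.* a ℤ.- u)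
  shuffle = solve-∀

contract-zeroˡ : ∀ {f : Y → ℤ} φ {ys} → All (λ y → f y ≡ 0ℤ) ys → contract f φ ys ≡ 0ℤ
contract-zeroˡ φ []                 = refl
contract-zeroˡ φ (_∷_ {y} {ys} z zs) rewrite z | contract-zeroˡ (φ ∘ (y ∷_)) zs = refl

contract-zeroʳ : ∀ (f : Y → ℤ) {φ} ys → (∀ zs → φ zs ≡ 0ℤ) → contract f φ ys ≡ 0ℤ
contract-zeroʳ f []       z = refl
contract-zeroʳ f (y ∷ ys) z
  rewrite z ys | contract-zeroʳ f ys (λ zs → z (y ∷ zs)) | ℤ.*-zeroʳ (f y) = refl

contract-linearˡ : ∀ c (f g : Y → ℤ) φ ys →
  contract (λ y → c ℤ.* f y ℤ.+ g y) φ ys ≡ c ℤ.* contract f φ ys ℤ.+ contract g φ ys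
contract-linearˡ c f g φ []       = zero-case c
  where
  zero-case : ∀ c → 0ℤ ≡ c ℤ.* 0ℤ ℤ.+ 0ℤ
  zero-case = solve-∀
contract-linearˡ c f g φ (y ∷ ys) = trans
  (cong (λ u → (c ℤ.* f y ℤ.+ g y) ℤ.* φ ys ℤ.- u) (contract-linearˡ c f g (φ ∘ (y ∷_)) ys))
  (shuffle c (f y) (g y) (φ ys) _ _)
  where
  shuffle : ∀ c f g a u v → (c ℤ.* f ℤ.+ g) ℤ.* a ℤ.- (c ℤ.* u ℤ.+ v) ≡
                            c ℤ.* (f ℤ.* a ℤ.- u) ℤ.+ (g ℤ.* a ℤ.- v)
  shuffle = solve-∀

contract-∑ : ∀ (M : X → Y → ℤ) (c : X → ℤ) xs φ ys →
  contract (λ y → ∑ xs λ x → c x ℤ.* M x y) φ ys ≡ ∑ xs λ x → c x ℤ.* contract (M x) φ ys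
contract-∑ M c []       φ ys = contract-zeroˡ φ (All.universal (λ _ → refl) ys)
contract-∑ M c (x ∷ xs) φ ys = trans
  (contract-linearˡ (c x) (M x) _ φ ys)
  (cong (λ u → c x ℤ.* contract (M x) φ ys ℤ.+ u) (contract-∑ M c xs φ ys))

-- Deleting two entries in either order leaves the same list, but the sign of the later entry flips
-- once the earlier one is gone: the antisymmetry comes from the deletions, not from `φ`.
contract-anticomm : ∀ (f g : Y → ℤ) φ ys →
  contract f (contract g φ) ys ≡ ℤ.- contract g (contract f φ) ys
contract-anticomm f g φ []       = refl
contract-anticomm f g φ (y ∷ ys) = begin
  f y ℤ.* contract g φ ys ℤ.- contract f (λ zs → g y ℤ.* φ zs ℤ.- contract g (φ ∘ (y ∷_)) zs) ys
    ≡⟨ cong (λ u → f y ℤ.* contract g φ ys ℤ.- u) (contract-linear f (g y) φ _ ys) ⟩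
  f y ℤ.* contract g φ ys ℤ.- (g y ℤ.* contract f φ ys ℤ.- contract f (contract g (φ ∘ (y ∷_))) ys)
    ≡⟨ cong (λ u → f y ℤ.* contract g φ ys ℤ.- (g y ℤ.* contract f φ ys ℤ.- u))
            (contract-anticomm f g (φ ∘ (y ∷_)) ys) ⟩
  f y ℤ.* contract g φ ys ℤ.- (g y ℤ.* contract f φ ys ℤ.- ℤ.- contract g (contract f (φ ∘ (y ∷_))) ys)
    ≡⟨ shuffle (f y ℤ.* contract g φ ys) (g y ℤ.* contract f φ ys) _ ⟩
  ℤ.- (g y ℤ.* contract f φ ys ℤ.- (f y ℤ.* contract g φ ys ℤ.- contract g (contract f (φ ∘ (y ∷_))) ys))
    ≡⟨ cong (λ u → ℤ.- (g y ℤ.* contract f φ ys ℤ.- u)) (contract-linear g (f y) φ _ ys) ⟨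
  ℤ.- (g y ℤ.* contract f φ ys ℤ.- contract g (λ zs → f y ℤ.* φ zs ℤ.- contract f (φ ∘ (y ∷_)) zs) ys) ∎
  where
  shuffle : ∀ a b u → a ℤ.- (b ℤ.- ℤ.- u) ≡ ℤ.- (b ℤ.- (a ℤ.- u))
  shuffle = solve-∀

-- The two orders of deleting a pair of entries cancel. The recursion shows this directly, whereas
-- anticommutation only says that the value equals its own negative.
contract-self : ∀ (f : Y → ℤ) φ ys → contract f (contract f φ) ys ≡ 0ℤ
contract-self f φ []       = refl
contract-self f φ (y ∷ ys) = begin
  f y ℤ.* contract f φ ys ℤ.- contract f (λ zs → f y ℤ.* φ zs ℤ.- contract f (φ ∘ (y ∷_)) zs) ys
    ≡⟨ cong (λ u → f y ℤ.* contract f φ ys ℤ.- u) (contract-linear f (f y) φ _ ys) ⟩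
  f y ℤ.* contract f φ ys ℤ.- (f y ℤ.* contract f φ ys ℤ.- contract f (contract f (φ ∘ (y ∷_))) ys)
    ≡⟨ cong (λ u → f y ℤ.* contract f φ ys ℤ.- (f y ℤ.* contract f φ ys ℤ.- u))
            (contract-self f (φ ∘ (y ∷_)) ys) ⟩
  f y ℤ.* contract f φ ys ℤ.- (f y ℤ.* contract f φ ys ℤ.- 0ℤ)
    ≡⟨ shuffle (f y ℤ.* contract f φ ys) ⟩
  0ℤ ∎
  where
  shuffle : ∀ a → a ℤ.- (a ℤ.- 0ℤ) ≡ 0ℤ
  shuffle = solve-∀

-- Deletions from two different lists do not shift each other's positions, so they commute without a
-- sign.
contract-fubini : ∀ (f : Y → ℤ) (g : X → ℤ) (Θ : List X → List Y → ℤ) xs ys →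
  contract f (λ zs → contract g (λ ws → Θ ws zs) xs) ys ≡
  contract g (λ ws → contract f (Θ ws) ys) xs
contract-fubini f g Θ xs []       = sym (contract-zeroʳ g xs λ _ → refl)
contract-fubini f g Θ xs (y ∷ ys) = trans
  (cong (λ u → f y ℤ.* contract g (λ ws → Θ ws ys) xs ℤ.- u)
        (contract-fubini f g (λ ws zs → Θ ws (y ∷ zs)) xs ys))
  (sym (contract-linear g (f y) _ _ xs))

-- Deleting an entry of `pre` contributes nothing; passing over each of them costs one sign.
contract-++ : ∀ {f : Y → ℤ} φ {pre} ys → All (λ y → f y ≡ 0ℤ) pre →
  contract f φ (pre ++ ys) ≡ sgn (length pre) ℤ.* contract f (φ ∘ (pre ++_)) ys
contract-++ φ ys []                   = sym (ℤ.*-identityˡ _)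
contract-++ {f = f} φ ys (_∷_ {y} {pre} z zs) = begin
  f y ℤ.* φ (pre ++ ys) ℤ.- contract f (φ ∘ (y ∷_)) (pre ++ ys)
    ≡⟨ cong₂ (λ a b → a ℤ.* φ (pre ++ ys) ℤ.- b) z (contract-++ (φ ∘ (y ∷_)) ys zs) ⟩
  0ℤ ℤ.* φ (pre ++ ys) ℤ.- sgn (length pre) ℤ.* contract f (φ ∘ ((y ∷ pre) ++_)) ys
    ≡⟨ shuffle (φ (pre ++ ys)) (sgn (length pre)) _ ⟩
  (-1ℤ ℤ.* sgn (length pre)) ℤ.* contract f (φ ∘ ((y ∷ pre) ++_)) ys ∎
  where
  shuffle : ∀ a s u → 0ℤ ℤ.* a ℤ.- s ℤ.* u ≡ (-1ℤ ℤ.* s) ℤ.* u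
  shuffle = solve-∀

contract-map : ∀ (f : Y → ℤ) (h : Y′ → Y) φ ys →
  contract f φ (map h ys) ≡ contract (f ∘ h) (φ ∘ map h) ys
contract-map f h φ []       = refl
contract-map f h φ (y ∷ ys) =
  cong (λ u → f (h y) ℤ.* φ (map h ys) ℤ.- u) (contract-map f h (φ ∘ (h y ∷_)) ys)

-- Rules for iterated contractions

contractAll-++ : ∀ (M : X → Y → ℤ) xs xs′ φ ys →
  contractAll M (xs ++ xs′) φ ys ≡ contractAll M xs (contractAll M xs′ φ) ys
contractAll-++ M []       xs′ φ ys = refl
contractAll-++ M (x ∷ xs) xs′ φ ys =
  contract-cong ys λ zs _ → contractAll-++ M xs xs′ φ zs

-- The outer copy of `x` anticommutes inwards until it meets the inner one, where `contract-self`
-- applies.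
contractAll-repeat : ∀ (M : X → Y → ℤ) {x xs} φ ys → x ∈ xs →
  contract (M x) (contractAll M xs φ) ys ≡ 0ℤ
contractAll-repeat M {xs = x ∷ xs} φ ys (here refl) = contract-self (M x) _ ys
contractAll-repeat M {x} {x′ ∷ xs} φ ys (there x∈xs) = begin
  contract (M x) (contract (M x′) (contractAll M xs φ)) ys
    ≡⟨ contract-anticomm (M x) (M x′) _ ys ⟩
  ℤ.- contract (M x′) (contract (M x) (contractAll M xs φ)) ys
    ≡⟨ cong ℤ.-_ (contract-zeroʳ (M x′) ys λ zs → contractAll-repeat M φ zs x∈xs) ⟩
  0ℤ ∎

-- The outermost covector passes each row in turn, at one sign per row, and becomes the innermost.
contractAll-move : ∀ (f : Y → ℤ) (M : X → Y → ℤ) xs φ ys →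
  contract f (contractAll M xs φ) ys ≡ sgn (length xs) ℤ.* contractAll M xs (contract f φ) ys
contractAll-move f M []       φ ys = sym (ℤ.*-identityˡ _)
contractAll-move f M (x ∷ xs) φ ys = begin
  contract f (contract (M x) (contractAll M xs φ)) ys
    ≡⟨ contract-anticomm f (M x) _ ys ⟩
  ℤ.- contract (M x) (contract f (contractAll M xs φ)) ys
    ≡⟨ cong ℤ.-_ (contract-cong ys λ zs _ → contractAll-move f M xs φ zs) ⟩
  ℤ.- contract (M x) (λ zs → sgn (length xs) ℤ.* contractAll M xs (contract f φ) zs) ys
    ≡⟨ cong ℤ.-_ (contract-scale (M x) (sgn (length xs)) _ ys) ⟩
  ℤ.- (sgn (length xs) ℤ.* contractAll M (x ∷ xs) (contract f φ) ys)
    ≡⟨ shuffle (sgn (length xs)) _ ⟩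
  sgn (length (x ∷ xs)) ℤ.* contractAll M (x ∷ xs) (contract f φ) ys ∎
  where
  shuffle : ∀ s u → ℤ.- (s ℤ.* u) ≡ (-1ℤ ℤ.* s) ℤ.* u
  shuffle = solve-∀

-- Every row in `xs` has to pass over the whole of `pre`, which no deletion shortens; hence the
-- power of the sign.
contractAll-skip : ∀ (M : X → Y → ℤ) {xs pre} φ ys →
  All (λ x → All (λ y → M x y ≡ 0ℤ) pre) xs →
  contractAll M xs φ (pre ++ ys) ≡
  sgn (length pre) ℤ.^ length xs ℤ.* contractAll M xs (φ ∘ (pre ++_)) ys
contractAll-skip M φ ys []                        = sym (ℤ.*-identityˡ _)
contractAll-skip M {pre = pre} φ ys (_∷_ {x} {xs} z zs) = begin
  contract (M x) (contractAll M xs φ) (pre ++ ys)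
    ≡⟨ contract-++ _ ys z ⟩
  s ℤ.* contract (M x) (contractAll M xs φ ∘ (pre ++_)) ys
    ≡⟨ cong (s ℤ.*_) (contract-cong ys λ ws _ → contractAll-skip M φ ws zs) ⟩
  s ℤ.* contract (M x) (λ ws → s ℤ.^ length xs ℤ.* contractAll M xs (φ ∘ (pre ++_)) ws) ys
    ≡⟨ cong (s ℤ.*_) (contract-scale (M x) (s ℤ.^ length xs) _ ys) ⟩
  s ℤ.* (s ℤ.^ length xs ℤ.* contractAll M (x ∷ xs) (φ ∘ (pre ++_)) ys)
    ≡⟨ ℤ.*-assoc s _ _ ⟨
  s ℤ.* s ℤ.^ length xs ℤ.* contractAll M (x ∷ xs) (φ ∘ (pre ++_)) ys ∎
  where s = sgn (length pre)

-- The rows use up all columns, so `φ` is only ever evaluated at `[]` and factors out.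
contractAll-full : ∀ (M : X → Y → ℤ) xs φ ys → length xs ≡ length ys →
  contractAll M xs φ ys ≡ φ [] ℤ.* detL M xs ys
contractAll-full M []       φ []       eq = sym (ℤ.*-identityʳ _)
contractAll-full M (x ∷ xs) φ ys       eq = trans
  (contract-cong ys λ zs len →
    contractAll-full M xs φ zs (ℕ.suc-injective (trans eq (sym len))))
  (contract-scale (M x) (φ []) (detL M xs) ys)

-- Column expansion, transposition and triangular matrices

detL-expand-column : ∀ (M : X → Y → ℤ) xs y ys →
  detL M xs (y ∷ ys) ≡ contract (flip M y) (λ ws → detL M ws ys) xs
detL-expand-column M []       y ys = refl
-- Either row `x` takes column `y`, or `y` is left to the rows `xs`; in the second case the deletion
-- of a column by `x` is interchanged with that of a row by `y`.
detL-expand-column M (x ∷ xs) y ys = cong (λ u → M x y ℤ.* detL M xs ys ℤ.- u) (trans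
  (contract-cong ys λ zs _ → detL-expand-column M xs y zs)
  (contract-fubini (M x) (flip M y) (detL M) xs ys))

-- Expansion along the first row of one matrix is expansion along the first column of the other.
detL-transpose : ∀ (M : X → Y → ℤ) xs ys → detL M xs ys ≡ detL (flip M) ys xs
detL-transpose M []       []      = refl
detL-transpose M []       (_ ∷ _) = refl
detL-transpose M (x ∷ xs) ys      = trans
  (contract-cong ys λ zs _ → detL-transpose M xs zs)
  (sym (detL-expand-column (flip M) ys x xs))

detL-map : ∀ (M : X → Y → ℤ) (g : X′ → X) (h : Y′ → Y) xs ys →
  detL M (map g xs) (map h ys) ≡ detL (λ x y → M (g x) (h y)) xs ys
detL-map M g h []       []      = refl
detL-map M g h []       (_ ∷ _) = refl
detL-map M g h (x ∷ xs) ys      = trans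
  (contract-map (M (g x)) h _ ys)
  (contract-cong ys λ zs _ → detL-map M g h xs zs)

detL-unitriangular : ∀ (M : X → X → ℤ) xs → All (λ x → M x x ≡ 1ℤ) xs →
  AllPairs (λ x y → M y x ≡ 0ℤ) xs → detL M xs xs ≡ 1ℤ
detL-unitriangular M []       diag       tri        = refl
detL-unitriangular M (x ∷ xs) (d ∷ diag) (t ∷ tri) = begin
  M x x ℤ.* detL M xs xs ℤ.- contract (M x) (λ zs → detL M xs (x ∷ zs)) xs
    ≡⟨ cong₂ (λ a b → a ℤ.* detL M xs xs ℤ.- b) d
         -- A minor that keeps column `x` has it as first column over the rows `xs`, where it is
         -- zero.
         (contract-zeroʳ (M x) xs λ zs →
           trans (detL-expand-column M xs x zs) (contract-zeroˡ _ t)) ⟩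
  1ℤ ℤ.* detL M xs xs ℤ.- 0ℤ
    ≡⟨ cong (λ u → 1ℤ ℤ.* u ℤ.- 0ℤ) (detL-unitriangular M xs diag tri) ⟩
  1ℤ ∎

-- Finite sums and the exchange of a row

∑-zero : ∀ {F : X → ℤ} xs → All (λ x → F x ≡ 0ℤ) xs → ∑ xs F ≡ 0ℤ
∑-zero []       []       = refl
∑-zero (x ∷ xs) (z ∷ zs) rewrite z | ∑-zero xs zs = refl

∑-++ : ∀ (F : X → ℤ) xs ys → ∑ (xs ++ ys) F ≡ ∑ xs F ℤ.+ ∑ ys F
∑-++ F []       ys = sym (ℤ.+-identityˡ _)
∑-++ F (x ∷ xs) ys = trans (cong (λ u → F x ℤ.+ u) (∑-++ F xs ys)) (sym (ℤ.+-assoc (F x) _ _))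

-- Cramer's rule: a linear relation between the rows x ∷ xs ∷ʳ x′ lets x be
-- exchanged for x′, at the price of the coefficient of x′ and a sign.
detL-exchange : ∀ (M : X → Y → ℤ) (c : X → ℤ) x xs x′ ys → c x ≡ 1ℤ →
  All (λ y → ∑ (x ∷ xs ∷ʳ x′) (λ w → c w ℤ.* M w y) ≡ 0ℤ) ys →
  detL M (x ∷ xs) ys ≡ ℤ.- (c x′ ℤ.* (sgn (length xs) ℤ.* detL M (xs ∷ʳ x′) ys))
detL-exchange M c x xs x′ ys cx≡1 rel = begin
  D x
    ≡⟨ shuffle (D x) (c x′ ℤ.* D x′) ⟩
  (1ℤ ℤ.* D x ℤ.+ (0ℤ ℤ.+ (c x′ ℤ.* D x′ ℤ.+ 0ℤ))) ℤ.- c x′ ℤ.* D x′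
    ≡⟨ cong (λ u → u ℤ.- c x′ ℤ.* D x′) relation ⟩
  0ℤ ℤ.- c x′ ℤ.* D x′
    ≡⟨ ℤ.+-identityˡ _ ⟩
  ℤ.- (c x′ ℤ.* D x′)
    ≡⟨ cong (λ u → ℤ.- (c x′ ℤ.* u)) (trans
         (contractAll-move (M x′) M xs δ[] ys)
         (cong (sgn (length xs) ℤ.*_) (sym (contractAll-++ M xs [ x′ ] δ[] ys)))) ⟩
  ℤ.- (c x′ ℤ.* (sgn (length xs) ℤ.* detL M (xs ∷ʳ x′) ys)) ∎
  where
  -- The determinant with first row replaced by `w`. It vanishes for `w` in `xs`, which reduces the
  -- relation to its terms at `x` and `x′`.
  D = λ w → contract (M w) (detL M xs) ys

  shuffle : ∀ a b → a ≡ (1ℤ ℤ.* a ℤ.+ (0ℤ ℤ.+ (b ℤ.+ 0ℤ))) ℤ.- b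
  shuffle = solve-∀

  inner : ∑ xs (λ w → c w ℤ.* D w) ≡ 0ℤ
  inner = ∑-zero xs (All.tabulate λ {w} w∈xs → trans
    (cong (c w ℤ.*_) (contractAll-repeat M δ[] ys w∈xs)) (ℤ.*-zeroʳ (c w)))

  relation : 1ℤ ℤ.* D x ℤ.+ (0ℤ ℤ.+ (c x′ ℤ.* D x′ ℤ.+ 0ℤ)) ≡ 0ℤ
  relation = begin
    1ℤ ℤ.* D x ℤ.+ (0ℤ ℤ.+ (c x′ ℤ.* D x′ ℤ.+ 0ℤ))
      ≡⟨ cong₂ (λ a b → a ℤ.* D x ℤ.+ (b ℤ.+ (c x′ ℤ.* D x′ ℤ.+ 0ℤ))) cx≡1 inner ⟨
    c x ℤ.* D x ℤ.+ (∑ xs (λ w → c w ℤ.* D w) ℤ.+ ∑ [ x′ ] (λ w → c w ℤ.* D w))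
      ≡⟨ cong (λ u → c x ℤ.* D x ℤ.+ u) (∑-++ (λ w → c w ℤ.* D w) xs [ x′ ]) ⟨
    ∑ (x ∷ xs ∷ʳ x′) (λ w → c w ℤ.* D w)
      ≡⟨ contract-∑ M c (x ∷ xs ∷ʳ x′) (detL M xs) ys ⟨
    contract (λ y → ∑ (x ∷ xs ∷ʳ x′) λ w → c w ℤ.* M w y) (detL M xs) ys
      ≡⟨ contract-zeroˡ (detL M xs) rel ⟩
    0ℤ ∎

-- Permuting rows and columns

↭-parity : {xs ys : List X} → xs ↭ ys → ℕ
↭-parity ↭.refl         = 0
↭-parity (↭.prep x p)   = ↭-parity p
↭-parity (↭.swap x y p) = suc (↭-parity p)
↭-parity (↭.trans p q)  = ↭-parity p + ↭-parity q

contractAll-↭ : ∀ (M : X → Y → ℤ) {xs xs′} (p : xs ↭ xs′) φ ys →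
  contractAll M xs φ ys ≡ sgn (↭-parity p) ℤ.* contractAll M xs′ φ ys
contractAll-↭ M ↭.refl         φ ys = sym (ℤ.*-identityˡ _)
contractAll-↭ M (↭.prep x p)   φ ys = trans
  (contract-cong ys λ zs _ → contractAll-↭ M p φ zs)
  (contract-scale (M x) (sgn (↭-parity p)) _ ys)
contractAll-↭ M (↭.swap {xs} {xs′} x y p) φ ys = begin
  contract (M x) (contract (M y) (contractAll M xs φ)) ys
    ≡⟨ contract-anticomm (M x) (M y) _ ys ⟩
  ℤ.- contractAll M (y ∷ x ∷ xs) φ ys
    ≡⟨ cong ℤ.-_ (contract-cong ys λ zs _ → trans
         (contract-cong zs λ ws _ → contractAll-↭ M p φ ws)
         (contract-scale (M x) (sgn (↭-parity p)) _ zs)) ⟩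
  ℤ.- contract (M y) (λ zs → sgn (↭-parity p) ℤ.* contractAll M (x ∷ xs′) φ zs) ys
    ≡⟨ cong ℤ.-_ (contract-scale (M y) (sgn (↭-parity p)) _ ys) ⟩
  ℤ.- (sgn (↭-parity p) ℤ.* contractAll M (y ∷ x ∷ xs′) φ ys)
    ≡⟨ shuffle (sgn (↭-parity p)) _ ⟩
  (-1ℤ ℤ.* sgn (↭-parity p)) ℤ.* contractAll M (y ∷ x ∷ xs′) φ ys ∎
  where
  shuffle : ∀ s u → ℤ.- (s ℤ.* u) ≡ (-1ℤ ℤ.* s) ℤ.* u
  shuffle = solve-∀
contractAll-↭ M (↭.trans {xs} {ws} {xs′} p q) φ ys = begin
  contractAll M xs φ ys
    ≡⟨ contractAll-↭ M p φ ys ⟩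
  sgn (↭-parity p) ℤ.* contractAll M ws φ ys
    ≡⟨ cong (sgn (↭-parity p) ℤ.*_) (contractAll-↭ M q φ ys) ⟩
  sgn (↭-parity p) ℤ.* (sgn (↭-parity q) ℤ.* contractAll M xs′ φ ys)
    ≡⟨ ℤ.*-assoc (sgn (↭-parity p)) _ _ ⟨
  sgn (↭-parity p) ℤ.* sgn (↭-parity q) ℤ.* contractAll M xs′ φ ys
    ≡⟨ cong (ℤ._* contractAll M xs′ φ ys) (sgn-+ (↭-parity p) (↭-parity q)) ⟨
  sgn (↭-parity p + ↭-parity q) ℤ.* contractAll M xs′ φ ys ∎

-- Rows and columns undergo the same permutation, so its sign enters squared, whichever derivation
-- the parity is read off. This gives independence of the enumeration of the vertices.
detL-relabel : ∀ (M : X → X → ℤ) {xs xs′} → xs ↭ xs′ → detL M xs xs ≡ detL M xs′ xs′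
detL-relabel M {xs} {xs′} p = begin
  detL M xs xs
    ≡⟨ contractAll-↭ M p δ[] xs ⟩
  s ℤ.* detL M xs′ xs
    ≡⟨ cong (s ℤ.*_) (detL-transpose M xs′ xs) ⟩
  s ℤ.* detL (flip M) xs xs′
    ≡⟨ cong (s ℤ.*_) (contractAll-↭ (flip M) p δ[] xs′) ⟩
  s ℤ.* (s ℤ.* detL (flip M) xs′ xs′)
    ≡⟨ ℤ.*-assoc s s _ ⟨
  s ℤ.* s ℤ.* detL (flip M) xs′ xs′
    ≡⟨ cong₂ ℤ._*_ (sgn-square (↭-parity p)) (sym (detL-transpose M xs′ xs′)) ⟩
  1ℤ ℤ.* detL M xs′ xs′
    ≡⟨ ℤ.*-identityˡ _ ⟩
  detL M xs′ xs′ ∎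
  where s = sgn (↭-parity p)

-- Determinants of bipartite graphs

sgn-^-self : ∀ m → sgn m ℤ.^ m ≡ sgn m
sgn-^-self m with ℤ.^-*-assoc -1ℤ m m
... | eq = trans eq (go m)
  where
  go : ∀ m → sgn (m * m) ≡ sgn m
  go zero    = refl
  go (suc m) = cong (-1ℤ ℤ.*_) (begin
    sgn (m + m * suc m)
      ≡⟨ cong (λ u → sgn (m + u)) (ℕ.*-suc m m) ⟩
    sgn (m + (m + m * m))
      ≡⟨ sgn-+ m _ ⟩
    sgn m ℤ.* sgn (m + m * m)
      ≡⟨ cong (sgn m ℤ.*_) (sgn-+ m _) ⟩
    sgn m ℤ.* (sgn m ℤ.* sgn (m * m))
      ≡⟨ ℤ.*-assoc (sgn m) _ _ ⟨
    sgn m ℤ.* sgn m ℤ.* sgn (m * m)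
      ≡⟨ cong₂ ℤ._*_ (sgn-square m) (go m) ⟩
    1ℤ ℤ.* sgn m
      ≡⟨ ℤ.*-identityˡ _ ⟩
    sgn m ∎)

-- The rows `os` must use up exactly the columns `es`, which leaves the columns `os` to the rows
-- `es`. With `m = length os`, passing over `m` columns `m` times gives the sign; symmetry
-- identifies the two blocks.
detL-bipartite : ∀ (M : X → X → ℤ) os es → length os ≡ length es →
  (∀ {x y} → M x y ≡ M y x) →
  All (λ x → All (λ y → M x y ≡ 0ℤ) os) os →
  detL M (os ++ es) (os ++ es) ≡ sgn (length os) ℤ.* (detL M es os ℤ.* detL M es os)
detL-bipartite M os es eq sym-M zeros = begin
  detL M (os ++ es) (os ++ es)
    ≡⟨ contractAll-++ M os es δ[] (os ++ es) ⟩
  contractAll M os (detL M es) (os ++ es)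
    ≡⟨ contractAll-skip M (detL M es) es zeros ⟩
  sgn (length os) ℤ.^ length os ℤ.* contractAll M os (detL M es ∘ (os ++_)) es
    ≡⟨ cong₂ ℤ._*_ (sgn-^-self (length os)) (contractAll-full M os _ es eq) ⟩
  sgn (length os) ℤ.* (detL M es (os ++ []) ℤ.* detL M os es)
    ≡⟨ cong₂ (λ l d → sgn (length os) ℤ.* (detL M es l ℤ.* d)) (List.++-identityʳ os) symmetric ⟩
  sgn (length os) ℤ.* (detL M es os ℤ.* detL M es os) ∎
  where
  detL-flip : ∀ xs ys → detL (flip M) xs ys ≡ detL M xs ys
  detL-flip []       ys = refl
  detL-flip (x ∷ xs) ys = trans
    (contract-cong ys λ zs _ → detL-flip xs zs)
    (contract-congˡ (λ _ → sym-M) _ ys)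

  symmetric : detL M os es ≡ detL M es os
  symmetric = trans (detL-transpose M os es) (detL-flip es os)

-- Comparison with cofactor expansion

sum-minors : ∀ {n} (f : Y → ℤ) φ (h : Fin (suc n) → Y) →
  sum (λ j → sgn (toℕ j) ℤ.* f (h j) ℤ.* φ (tabulate (h ∘ punchIn j))) ≡
  contract f φ (tabulate h)
sum-minors {n = zero} f φ h = shuffle (f (h zero)) (φ [])
  where
  shuffle : ∀ a b → 1ℤ ℤ.* a ℤ.* b ℤ.+ 0ℤ ≡ a ℤ.* b ℤ.- 0ℤ
  shuffle = solve-∀
sum-minors {n = suc n} f φ h = begin
  head ℤ.+ sum (λ j → -1ℤ ℤ.* sgn (toℕ j) ℤ.* f (h (suc j)) ℤ.* ψ j)
    ≡⟨ cong₂ ℤ._+_ (cong (ℤ._* φ (tabulate (h ∘ suc))) (ℤ.*-identityˡ (f (h zero))))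
        (trans (sum-cong-≗ λ j → shuffle (sgn (toℕ j)) (f (h (suc j))) (ψ j))
               (sym (sum-neg λ j → sgn (toℕ j) ℤ.* f (h (suc j)) ℤ.* ψ j))) ⟩
  f (h zero) ℤ.* φ (tabulate (h ∘ suc)) ℤ.-
    sum (λ j → sgn (toℕ j) ℤ.* f (h (suc j)) ℤ.* ψ j)
    ≡⟨ cong (λ u → f (h zero) ℤ.* φ (tabulate (h ∘ suc)) ℤ.- u)
            (sum-minors f (φ ∘ (h zero ∷_)) (h ∘ suc)) ⟩
  contract f φ (tabulate h) ∎
  where
  head = 1ℤ ℤ.* f (h zero) ℤ.* φ (tabulate (h ∘ suc))
  ψ = λ j → φ (h zero ∷ tabulate (h ∘ suc ∘ punchIn j))

  shuffle : ∀ s a b → -1ℤ ℤ.* s ℤ.* a ℤ.* b ≡ ℤ.- (s ℤ.* a ℤ.* b)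
  shuffle = solve-∀

  sum-neg : ∀ {m} (t : Fin m → ℤ) → ℤ.- sum t ≡ sum (λ j → ℤ.- t j)
  sum-neg {zero}  t = refl
  sum-neg {suc m} t = trans (ℤ.neg-distrib-+ (t zero) _)
                            (cong (λ u → ℤ.- t zero ℤ.+ u) (sum-neg (t ∘ suc)))

-- Rows and columns carry separate labellings because a minor drops the first row but the `j`-th
-- column.
det≡detL : ∀ (M : X → Y → ℤ) {n} (g : Fin n → X) (h : Fin n → Y) →
  det (λ r c → M (g r) (h c)) ≡ detL M (tabulate g) (tabulate h)
det≡detL M {zero}  g h = refl
det≡detL M {suc n} g h = trans
  (sum-cong-≗ λ j → cong (sgn (toℕ j) ℤ.* M (g zero) (h j) ℤ.*_)
    (det≡detL M (g ∘ suc) (h ∘ punchIn j)))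
  (sum-minors (M (g zero)) (detL M (tabulate (g ∘ suc))) h)

-- The hexagonal grid in lattice coordinates

Point : Set
Point = ℕ × ℕ

_≟ᵖ_ : (r s : Point) → Dec (r ≡ s)
_≟ᵖ_ = ≡-dec _≟_ _≟_

indicator : {P : Set} → Dec P → ℤ
indicator P? = if does P? then 1ℤ else 0ℤ

indicator-yes : {P : Set} (P? : Dec P) → P → indicator P? ≡ 1ℤ
indicator-yes P? p rewrite dec-true P? p = refl

indicator-no : {P : Set} (P? : Dec P) → ¬ P → indicator P? ≡ 0ℤ
indicator-no P? ¬p rewrite dec-false P? ¬p = refl

-- The number `u` is given by its two values because in use it is the indicator of adjacency, a
-- different proposition that is only shown equivalent to the three cases.
indicator-split : {P Q R : Set} (P? : Dec P) (Q? : Dec Q) (R? : Dec R) →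
  (P → ¬ Q) → (P → ¬ R) → (Q → ¬ R) →
  ∀ {u} → (P ⊎ Q ⊎ R → u ≡ 1ℤ) → (¬ (P ⊎ Q ⊎ R) → u ≡ 0ℤ) →
  u ≡ indicator P? ℤ.+ (indicator Q? ℤ.+ indicator R?)
indicator-split (yes p) (yes q) R?      p¬q p¬r q¬r is-one is-zero = contradiction q (p¬q p)
indicator-split (yes p) (no ¬q) (yes r) p¬q p¬r q¬r is-one is-zero = contradiction r (p¬r p)
indicator-split (yes p) (no ¬q) (no ¬r) p¬q p¬r q¬r is-one is-zero = is-one (inj₁ p)
indicator-split (no ¬p) (yes q) (yes r) p¬q p¬r q¬r is-one is-zero = contradiction r (q¬r q)
indicator-split (no ¬p) (yes q) (no ¬r) p¬q p¬r q¬r is-one is-zero = is-one (inj₂ (inj₁ q))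
indicator-split (no ¬p) (no ¬q) (yes r) p¬q p¬r q¬r is-one is-zero = is-one (inj₂ (inj₂ r))
indicator-split (no ¬p) (no ¬q) (no ¬r) p¬q p¬r q¬r is-one is-zero =
  is-zero [ ¬p , [ ¬q , ¬r ]′ ]′

right down : Point → Point
right (i , a) = i , suc a
down  (i , a) = suc i , a

right-injective : ∀ {r s} → right r ≡ right s → r ≡ s
right-injective refl = refl

down-injective : ∀ {r s} → down r ≡ down s → r ≡ s
down-injective refl = refl

-- Sums against indicators

∑-split : ∀ {X : Set} (c α β γ : X → ℤ) {F : X → ℤ} xs →
  (∀ x → F x ≡ α x ℤ.+ (β x ℤ.+ γ x)) →
  ∑ xs (λ x → c x ℤ.* F x) ≡
  ∑ xs (λ x → c x ℤ.* α x) ℤ.+ (∑ xs (λ x → c x ℤ.* β x) ℤ.+ ∑ xs (λ x → c x ℤ.* γ x))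
∑-split c α β γ []       eq = refl
∑-split c α β γ (x ∷ xs) eq = trans
  (cong₂ (λ a b → c x ℤ.* a ℤ.+ b) (eq x) (∑-split c α β γ xs eq))
  (shuffle (c x) (α x) (β x) (γ x) _ _ _)
  where
  shuffle : ∀ c a b d A B D → c ℤ.* (a ℤ.+ (b ℤ.+ d)) ℤ.+ (A ℤ.+ (B ℤ.+ D)) ≡
            (c ℤ.* a ℤ.+ A) ℤ.+ ((c ℤ.* b ℤ.+ B) ℤ.+ (c ℤ.* d ℤ.+ D))
  shuffle = solve-∀

∑-pick : ∀ {X : Set} (c χ : X → ℤ) {xs t} → Unique xs → t ∈ xs →
  χ t ≡ 1ℤ → (∀ s → s ≢ t → χ s ≡ 0ℤ) → ∑ xs (λ s → c s ℤ.* χ s) ≡ c t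
∑-pick c χ {x ∷ xs} (x∉xs ∷ u) (here refl) one others = begin
  c x ℤ.* χ x ℤ.+ ∑ xs (λ s → c s ℤ.* χ s)
    ≡⟨ cong₂ (λ a b → c x ℤ.* a ℤ.+ b) one
         (∑-zero xs (All.map (λ {s} x≢s →
           trans (cong (c s ℤ.*_) (others s (x≢s ∘ sym))) (ℤ.*-zeroʳ (c s))) x∉xs)) ⟩
  c x ℤ.* 1ℤ ℤ.+ 0ℤ
    ≡⟨ trans (ℤ.+-identityʳ _) (ℤ.*-identityʳ (c x)) ⟩
  c x ∎
∑-pick c χ {x ∷ xs} {t} (x∉xs ∷ u) (there t∈xs) one others = begin
  c x ℤ.* χ x ℤ.+ ∑ xs (λ s → c s ℤ.* χ s)
    ≡⟨ cong₂ (λ a b → c x ℤ.* a ℤ.+ b) (others x (All.lookup x∉xs t∈xs))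
         (∑-pick c χ u t∈xs one others) ⟩
  c x ℤ.* 0ℤ ℤ.+ c t
    ≡⟨ trans (cong (ℤ._+ c t) (ℤ.*-zeroʳ (c x))) (ℤ.+-identityˡ (c t)) ⟩
  c t ∎

∑-pick-injective : ∀ (c : Point → ℤ) (g : Point → Point) → (∀ {r s} → g r ≡ g s → r ≡ s) →
  ∀ {xs} t → Unique xs → t ∈ xs → ∑ xs (λ s → c s ℤ.* indicator (g s ≟ᵖ g t)) ≡ c t
∑-pick-injective c g g-inj t u t∈xs = ∑-pick c _ u t∈xs
  (indicator-yes (g t ≟ᵖ g t) refl)
  (λ s s≢t → indicator-no (g s ≟ᵖ g t) (s≢t ∘ g-inj))

∑-miss : ∀ (c : Point → ℤ) (g : Point → Point) r xs → (∀ s → g s ≢ r) →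
  ∑ xs (λ s → c s ℤ.* indicator (g s ≟ᵖ r)) ≡ 0ℤ
∑-miss c g r xs miss = ∑-zero xs (All.universal (λ s → trans
  (cong (c s ℤ.*_) (indicator-no (g s ≟ᵖ r) (miss s))) (ℤ.*-zeroʳ (c s))) xs)

rowOf : Point → ℕ
rowOf (i , zero)  = i
rowOf (i , suc a) = suc i

-- Zero-based coordinates for the vertices of odd and of even subscript, in
-- which v^i_1 counts as the left end of row i + 1: the neighbours of odd r are
-- then even r and even s for the left and upper neighbours s of r. The labels
-- odd (0 , 0) and even (q , p) do not belong to H_{p,q}.
odd even : Point → ℕ × ℕ
odd  r@(_ , a) = rowOf r , suc (2 * a)
even (i , a)   = suc i , suc (suc (2 * a))

double-injective : ∀ {a b} → 2 * a ≡ 2 * b → a ≡ b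
double-injective {a} {b} = ℕ.*-cancelˡ-≡ a b 2

odd-injective : ∀ {r s} → odd r ≡ odd s → r ≡ s
odd-injective {i , a} {j , b} eq
  with refl ← double-injective {a} {b} (ℕ.suc-injective (,-injectiveʳ eq)) = go a (,-injectiveˡ eq)
  where
  go : ∀ a → rowOf (i , a) ≡ rowOf (j , a) → (i , a) ≡ (j , a)
  go zero    refl = refl
  go (suc a) refl = refl

even-injective : ∀ {r s} → even r ≡ even s → r ≡ s
even-injective {i , a} {j , b} eq
  with refl ← double-injective {a} {b} (ℕ.suc-injective (ℕ.suc-injective (,-injectiveʳ eq)))
  with refl ← ,-injectiveˡ eq = refl

odd≢even : ∀ r s → odd r ≢ even s
odd≢even (_ , a) (_ , b) eq = ℕ.even≢odd a b (ℕ.suc-injective (,-injectiveʳ eq))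

-- Up to the sign (-1)^(i+a), the number of lattice paths from (0 , 0) to (i , a).
signedPaths : Point → ℤ
signedPaths (zero  , zero)  = 1ℤ
signedPaths (zero  , suc a) = ℤ.- signedPaths (zero , a)
signedPaths (suc i , zero)  = ℤ.- signedPaths (i , zero)
signedPaths (suc i , suc a) = ℤ.- (signedPaths (suc i , a) ℤ.+ signedPaths (i , suc a))

signedPaths-binomial : ∀ i a → signedPaths (i , a) ≡ sgn (i + a) ℤ.* + ((i + a) C i)
signedPaths-binomial zero    zero    = refl
signedPaths-binomial zero    (suc a) rewrite signedPaths-binomial zero a = shuffle (sgn a)
  where
  shuffle : ∀ s → ℤ.- (s ℤ.* 1ℤ) ≡ (-1ℤ ℤ.* s) ℤ.* 1ℤ
  shuffle = solve-∀
signedPaths-binomial (suc i) zero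
  rewrite signedPaths-binomial i zero | ℕ.+-identityʳ i | nCn≡1 i | nCn≡1 (suc i) = shuffle (sgn i)
  where
  shuffle : ∀ s → ℤ.- (s ℤ.* 1ℤ) ≡ (-1ℤ ℤ.* s) ℤ.* 1ℤ
  shuffle = solve-∀
signedPaths-binomial (suc i) (suc a) = begin
  ℤ.- (signedPaths (suc i , a) ℤ.+ signedPaths (i , suc a))
    ≡⟨ cong₂ (λ u v → ℤ.- (u ℤ.+ v)) (signedPaths-binomial (suc i) a) (signedPaths-binomial i (suc a)) ⟩
  ℤ.- (sgn (suc i + a) ℤ.* + ((suc i + a) C suc i) ℤ.+ sgn (i + suc a) ℤ.* + ((i + suc a) C i))
    ≡⟨ cong (λ m → ℤ.- (sgn m ℤ.* + (m C suc i) ℤ.+ sgn (i + suc a) ℤ.* + ((i + suc a) C i)))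
            (ℕ.+-suc i a) ⟨
  ℤ.- (s ℤ.* + (m C suc i) ℤ.+ s ℤ.* + (m C i))
    ≡⟨ shuffle s (+ (m C suc i)) (+ (m C i)) ⟩
  (-1ℤ ℤ.* s) ℤ.* (+ (m C i) ℤ.+ + (m C suc i))
    ≡⟨ cong (λ u → (-1ℤ ℤ.* s) ℤ.* + u) (nCk+nC[k+1]≡[n+1]C[k+1] m i) ⟩
  (-1ℤ ℤ.* s) ℤ.* + (suc m C suc i) ∎
  where
  m = i + suc a
  s = sgn m
  shuffle : ∀ s a b → ℤ.- (s ℤ.* a ℤ.+ s ℤ.* b) ≡ (-1ℤ ℤ.* s) ℤ.* (b ℤ.+ a)
  shuffle = solve-∀

-- The three sums pick out the values at `r`, at its left and at its upper neighbour, a missing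
-- neighbour giving zero; the recursion of `signedPaths` says that these cancel. At the origin the
-- total would be 1.
signedPaths-null : ∀ {xs} → Unique xs → ∀ r → r ∈ xs → r ≢ (0 , 0) →
  (∀ {s} → right s ≡ r → s ∈ xs) → (∀ {s} → down s ≡ r → s ∈ xs) →
  ∑ xs (λ s → signedPaths s ℤ.* indicator (s ≟ᵖ r)) ℤ.+
  (∑ xs (λ s → signedPaths s ℤ.* indicator (right s ≟ᵖ r)) ℤ.+
   ∑ xs (λ s → signedPaths s ℤ.* indicator (down s ≟ᵖ r))) ≡ 0ℤ
signedPaths-null {xs} u r@(zero , zero) r∈ r≢0 left∈ up∈ = contradiction refl r≢0
signedPaths-null {xs} u r@(zero , suc a) r∈ r≢0 left∈ up∈ = trans
  (cong₂ ℤ._+_ (∑-pick-injective signedPaths id id r u r∈) (cong₂ ℤ._+_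
    (∑-pick-injective signedPaths right right-injective (zero , a) u (left∈ refl))
    (∑-miss signedPaths down r xs λ _ ())))
  (cancel (signedPaths (zero , a)))
  where
  cancel : ∀ u → ℤ.- u ℤ.+ (u ℤ.+ 0ℤ) ≡ 0ℤ
  cancel = solve-∀
signedPaths-null {xs} u r@(suc i , zero) r∈ r≢0 left∈ up∈ = trans
  (cong₂ ℤ._+_ (∑-pick-injective signedPaths id id r u r∈) (cong₂ ℤ._+_
    (∑-miss signedPaths right r xs λ _ ())
    (∑-pick-injective signedPaths down down-injective (i , zero) u (up∈ refl))))
  (cancel (signedPaths (i , zero)))
  where
  cancel : ∀ u → ℤ.- u ℤ.+ (0ℤ ℤ.+ u) ≡ 0ℤ
  cancel = solve-∀
signedPaths-null {xs} u r@(suc i , suc a) r∈ r≢0 left∈ up∈ = trans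
  (cong₂ ℤ._+_ (∑-pick-injective signedPaths id id r u r∈) (cong₂ ℤ._+_
    (∑-pick-injective signedPaths right right-injective (suc i , a) u (left∈ refl))
    (∑-pick-injective signedPaths down down-injective (i , suc a) u (up∈ refl))))
  (cancel (signedPaths (suc i , a)) (signedPaths (i , suc a)))
  where
  cancel : ∀ u v → ℤ.- (u ℤ.+ v) ℤ.+ (u ℤ.+ v) ≡ 0ℤ
  cancel = solve-∀

-- Lexicographic order and auxiliary facts on lists

_≺_ : Point → Point → Set
(i , a) ≺ (j , b) = i < j ⊎ (i ≡ j × a < b)

≺⇒≢ : ∀ {r s} → r ≺ s → r ≢ s
≺⇒≢ (inj₁ i<i)       refl = ℕ.<-irrefl refl i<i
≺⇒≢ (inj₂ (_ , a<a)) refl = ℕ.<-irrefl refl a<a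

cartesianProduct-sorted : ∀ {xs ys} → AllPairs _<_ xs → AllPairs _<_ ys →
  AllPairs _≺_ (cartesianProduct xs ys)
cartesianProduct-sorted []                      ys< = []
cartesianProduct-sorted {x ∷ xs} {ys} (x< ∷ xs<) ys< = AllPairs.++⁺
  (AllPairs.map⁺ (AllPairs.map (λ a<b → inj₂ (refl , a<b)) ys<))
  (cartesianProduct-sorted xs< ys<)
  (All.map⁺ (All.universal (λ a → All.cartesianProduct⁺ (setoid ℕ) (setoid ℕ) xs ys
    λ j∈xs _ → inj₁ (All.lookup x< j∈xs)) ys))

halve : ∀ m → ∃[ a ] (m ≡ 2 * a ⊎ m ≡ suc (2 * a))
halve zero = 0 , inj₁ refl
halve (suc m) with halve m
... | a , inj₁ refl = a , inj₂ refl
... | a , inj₂ refl = suc a , inj₁ (sym (ℕ.*-suc 2 a))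

upTo-sorted : ∀ n → AllPairs _<_ (upTo n)
upTo-sorted n = AllPairs.applyUpTo⁺₁ id n λ i<j _ → i<j

AllPairs-∷ʳ⁻ : ∀ {X : Set} {R : X → X → Set} xs {y x} → AllPairs R (xs ∷ʳ y) → x ∈ xs → R x y
AllPairs-∷ʳ⁻ (x ∷ xs) (Rx ∷ Rxs) (here refl)  = All.lookup Rx (∈-++⁺ʳ xs (here refl))
AllPairs-∷ʳ⁻ (x ∷ xs) (Rx ∷ Rxs) (there x∈xs) = AllPairs-∷ʳ⁻ xs Rxs x∈xs

Unique-++⁻ˡ : ∀ {X : Set} xs {ys : List X} → Unique (xs ++ ys) → Unique xs
Unique-++⁻ˡ []       u        = []
Unique-++⁻ˡ (x ∷ xs) (x∉ ∷ u) = All.++⁻ˡ xs x∉ ∷ Unique-++⁻ˡ xs u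

length-cartesianProduct : ∀ {X Y : Set} (xs : List X) (ys : List Y) →
  length (cartesianProduct xs ys) ≡ length xs * length ys
length-cartesianProduct []       ys = refl
length-cartesianProduct (x ∷ xs) ys = trans (List.length-++ (map (x ,_) ys))
  (cong₂ _+_ (List.length-map (x ,_) ys) (length-cartesianProduct xs ys))

-- The grid and its two corners

module Grid (p q′ : ℕ) where
  open Hexagonal p (suc q′)

  q : ℕ
  q = suc q′

  grid : List Point
  grid = cartesianProduct (upTo (suc q)) (upTo (suc p))

  first last : Point
  first = 0 , 0
  last  = q , p

  -- In row-major order: the top row without `first`, the full rows strictly between, the bottom row
  -- without `last`. Writing `q` as `suc q′` keeps the top and bottom rows apart.
  middle : List Point
  middle = map (0 ,_) (applyUpTo suc p) ++
           cartesianProduct (applyUpTo suc q′) (upTo (suc p)) ++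
           map (q ,_) (upTo p)

  grid-split : grid ≡ first ∷ middle ∷ʳ last
  grid-split = begin
    cartesianProduct (upTo (suc q)) (upTo (suc p))
      ≡⟨ cong (λ xs → cartesianProduct xs (upTo (suc p))) (List.upTo-∷ʳ q) ⟨
    cartesianProduct (upTo q ∷ʳ q) (upTo (suc p))
      ≡⟨ List.cartesianProductWith-distribʳ-++ _,_ (upTo q) [ q ] (upTo (suc p)) ⟩
    cartesianProduct (upTo q) (upTo (suc p)) ++ (map (q ,_) (upTo (suc p)) ++ [])
      ≡⟨ cong (cartesianProduct (upTo q) (upTo (suc p)) ++_) (begin
           map (q ,_) (upTo (suc p)) ++ []
             ≡⟨ List.++-identityʳ _ ⟩
           map (q ,_) (upTo (suc p))
             ≡⟨ cong (map (q ,_)) (List.upTo-∷ʳ p) ⟨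
           map (q ,_) (upTo p ∷ʳ p)
             ≡⟨ List.map-++ (q ,_) (upTo p) [ p ] ⟩
           map (q ,_) (upTo p) ∷ʳ last ∎) ⟩
    (map (0 ,_) (upTo (suc p)) ++ rest) ++ (map (q ,_) (upTo p) ∷ʳ last)
      ≡⟨ List.++-assoc (map (0 ,_) (upTo (suc p)) ++ rest) (map (q ,_) (upTo p)) [ last ] ⟨
    ((map (0 ,_) (upTo (suc p)) ++ rest) ++ map (q ,_) (upTo p)) ∷ʳ last
      ≡⟨ cong (_∷ʳ last) (List.++-assoc (map (0 ,_) (upTo (suc p))) rest (map (q ,_) (upTo p))) ⟩
    first ∷ middle ∷ʳ last ∎
    where rest = cartesianProduct (applyUpTo suc q′) (upTo (suc p))

  grid-sorted : AllPairs _≺_ (first ∷ middle ∷ʳ last)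
  grid-sorted = subst (AllPairs _≺_) grid-split
    (cartesianProduct-sorted (upTo-sorted (suc q)) (upTo-sorted (suc p)))

  grid-unique : Unique (first ∷ middle ∷ʳ last)
  grid-unique = AllPairs.map ≺⇒≢ grid-sorted

  ∈-grid⁺ : ∀ {i a} → i ≤ q → a ≤ p → (i , a) ∈ first ∷ middle ∷ʳ last
  ∈-grid⁺ {i} {a} i≤q a≤p = subst ((i , a) ∈_) grid-split
    (∈-cartesianProduct⁺ (∈-upTo⁺ (s≤s i≤q)) (∈-upTo⁺ (s≤s a≤p)))

  ∈-grid⁻ : ∀ {i a} → (i , a) ∈ first ∷ middle ∷ʳ last → i ≤ q × a ≤ p
  ∈-grid⁻ {i} {a} r∈
    with i∈ , a∈ ← ∈-cartesianProduct⁻ (upTo (suc q)) (upTo (suc p))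
                     (subst ((i , a) ∈_) (sym grid-split) r∈)
    = ℕ.≤-pred (∈-upTo⁻ i∈) , ℕ.≤-pred (∈-upTo⁻ a∈)

  odds evens : List Point
  odds  = middle ∷ʳ last
  evens = first ∷ middle

  ∈-odds⁺ : ∀ {r} → r ∈ first ∷ odds → r ≢ first → r ∈ odds
  ∈-odds⁺ (here eq)  r≢ = contradiction eq r≢
  ∈-odds⁺ (there r∈) r≢ = r∈

  ∈-odds⁻ : ∀ {r} → r ∈ odds → r ≢ first
  ∈-odds⁻ r∈ refl = Unique.Unique[x∷xs]⇒x∉xs grid-unique r∈

  ∈-evens⁺ : ∀ {r} → r ∈ evens ∷ʳ last → r ≢ last → r ∈ evens
  ∈-evens⁺ r∈ r≢ with ∈-++⁻ evens r∈
  ... | inj₁ r∈evens  = r∈evens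
  ... | inj₂ (here eq) = contradiction eq r≢

  ∈-evens⁻ : ∀ {r} → r ∈ evens → r ≢ last
  ∈-evens⁻ = AllPairs-∷ʳ⁻ evens grid-unique

  length-odds : length odds ≡ length evens
  length-odds = trans (List.length-++ middle) (ℕ.+-comm (length middle) 1)

  length-evens : length evens ≡ p * q + q + p
  length-evens = ℕ.suc-injective (begin
    suc (length evens)
      ≡⟨ trans (List.length-++ evens) (ℕ.+-comm (length evens) 1) ⟨
    length (evens ∷ʳ last)
      ≡⟨ cong length grid-split ⟨
    length grid
      ≡⟨ length-cartesianProduct (upTo (suc q)) (upTo (suc p)) ⟩
    length (upTo (suc q)) * length (upTo (suc p))
      ≡⟨ cong₂ _*_ (List.length-upTo (suc q)) (List.length-upTo (suc p)) ⟩
    suc q * suc p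
      ≡⟨ shuffle q p ⟩
    suc (p * q + q + p) ∎)
    where
    shuffle : ∀ q p → suc q * suc p ≡ suc (p * q + q + p)
    shuffle = ℕ-Solver.solve-∀

  -- Adjacency in lattice coordinates

  Adjacent : ℕ × ℕ → ℕ × ℕ → Set
  Adjacent x y = Edge x y ⊎ Edge y x

  adjacent? : ∀ x y → Dec (Adjacent x y)
  adjacent? x y = edge? x y ⊎-dec edge? y x

  adjacency : ℕ × ℕ → ℕ × ℕ → ℤ
  adjacency x y = indicator (adjacent? x y)

  adjacency-sym : ∀ {x y} → adjacency x y ≡ adjacency y x
  adjacency-sym {x} {y} = cong (if_then 1ℤ else 0ℤ)
    (does-⇔ (mk⇔ swap swap) (adjacent? x y) (adjacent? y x))

  2*j+1 : ∀ j → 2 * j + 1 ≡ suc (2 * j)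
  2*j+1 j = ℕ.+-comm (2 * j) 1

  2*j+2 : ∀ j → 2 * j + 2 ≡ suc (suc (2 * j))
  2*j+2 j = ℕ.+-comm (2 * j) 2

  2*suc : ∀ a → 2 * suc a ≡ suc (suc (2 * a))
  2*suc = ℕ.*-suc 2

  -- In each of the three kinds of edge the two subscripts have opposite parity.
  ¬edge-odd-odd : ∀ r s → ¬ Edge (odd r) (odd s)
  ¬edge-odd-odd (_ , a) (_ , b) (inj₁ (_ , eq)) = ℕ.even≢odd b a (ℕ.suc-injective eq)
  ¬edge-odd-odd (_ , a) (_ , b) (inj₂ (inj₁ (_ , eq , _))) = ℕ.even≢odd a 0 (ℕ.suc-injective eq)
  ¬edge-odd-odd (_ , a) (_ , b) (inj₂ (inj₂ (_ , t , _ , eq))) =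
    ℕ.even≢odd b (suc (toℕ t)) (ℕ.suc-injective (trans eq (2*j+2 (suc (toℕ t)))))

  adjacency-odd-odd : ∀ r s → adjacency (odd r) (odd s) ≡ 0ℤ
  adjacency-odd-odd r s = indicator-no (adjacent? (odd r) (odd s))
    [ ¬edge-odd-odd r s , ¬edge-odd-odd s r ]′

  Step : Point → Point → Set
  Step s r = s ≡ r ⊎ right s ≡ r ⊎ down s ≡ r

  -- A path edge from an odd subscript to the next is an equality of points and an edge between two
  -- paths is a `down` step, except in column 0, where the shift of `v^i_1` to row `i` swaps these
  -- two roles. Path edges from an even subscript to the next, treated in `edge⇒step′`, are the
  -- `right` steps.
  edge⇒step : ∀ r s → Edge (odd r) (even s) → Step s r
  edge⇒step (i , a) (j , b) (inj₁ (eq , eq′))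
    with refl ← double-injective {b} {a} (ℕ.suc-injective (ℕ.suc-injective eq′)) = go b eq
    where
    go : ∀ b → rowOf (i , b) ≡ suc j → Step (j , b) (i , b)
    go zero    refl = inj₂ (inj₂ refl)
    go (suc b) refl = inj₁ refl
  edge⇒step (i , a) (j , b) (inj₂ (inj₁ (_ , eq , _))) =
    contradiction (ℕ.suc-injective eq) (ℕ.even≢odd a 0)
  edge⇒step (i , a) (j , b) (inj₂ (inj₂ (eq , t , eqa , eqb)))
    with refl ← double-injective {a} {suc (toℕ t)}
                  (ℕ.suc-injective (trans eqa (2*j+1 (suc (toℕ t)))))
    with refl ← double-injective {b} {suc (toℕ t)}
                  (ℕ.suc-injective (ℕ.suc-injective (trans eqb (2*j+2 (suc (toℕ t))))))
    with refl ← ℕ.suc-injective eq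
    = inj₂ (inj₂ refl)

  edge⇒step′ : ∀ r s → Edge (even s) (odd r) → Step s r
  edge⇒step′ (i , a) (j , b) (inj₁ (eq , eq′))
    with refl ← double-injective {a} {suc b} (trans (ℕ.suc-injective eq′) (sym (2*suc b)))
    with refl ← eq
    = inj₂ (inj₁ refl)
  edge⇒step′ (i , a) (j , b) (inj₂ (inj₁ (eq , eqb , eqa)))
    with refl ← double-injective {a} {0} (ℕ.suc-injective eqa)
    with refl ← double-injective {b} {0} (ℕ.suc-injective (ℕ.suc-injective eqb))
    with refl ← ℕ.suc-injective eq
    = inj₁ refl
  edge⇒step′ (i , a) (j , b) (inj₂ (inj₂ (_ , t , eq , _))) =
    contradiction (trans (2*suc b) (trans eq (2*j+1 (suc (toℕ t))))) (ℕ.even≢odd (suc b) (suc (toℕ t)))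

  step⇒adjacent : ∀ r s → proj₂ r ≤ p → Step s r → Adjacent (even s) (odd r)
  step⇒adjacent (i , zero)  s a≤p (inj₁ refl)        = inj₁ (inj₂ (inj₁ (refl , refl , refl)))
  step⇒adjacent (i , suc a) s a≤p (inj₁ refl)        = inj₂ (inj₁ (refl , refl))
  step⇒adjacent _ (j , b) a≤p (inj₂ (inj₁ refl))     = inj₁ (inj₁ (refl , cong suc (2*suc b)))
  step⇒adjacent (_ , zero)  s a≤p (inj₂ (inj₂ refl)) = inj₂ (inj₁ (refl , refl))
  -- The edge between paths has `j = a + 1`, so `t = a`, and the column bound makes it an element of
  -- `Fin p`.
  step⇒adjacent (_ , suc a) s a<p (inj₂ (inj₂ refl)) =
    inj₂ (inj₂ (inj₂ (refl , fromℕ< a<p , odd-eq , even-eq)))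
    where
    t≡a = toℕ-fromℕ< a<p
    odd-eq : suc (2 * suc a) ≡ 2 * suc (toℕ (fromℕ< a<p)) + 1
    odd-eq rewrite t≡a = sym (2*j+1 (suc a))
    even-eq : suc (suc (2 * suc a)) ≡ 2 * suc (toℕ (fromℕ< a<p)) + 2
    even-eq rewrite t≡a = sym (2*j+2 (suc a))

  -- Even vertices index the rows, so on the grid this is the transpose of `T`: a relation between
  -- columns of `T` is one between rows here.
  biadjacency : Point → Point → ℤ
  biadjacency s r = adjacency (even s) (odd r)

  ¬step⇒zero : ∀ s r → ¬ Step s r → biadjacency s r ≡ 0ℤ
  ¬step⇒zero s r ¬step = indicator-no (adjacent? (even s) (odd r))
    (¬step ∘ [ edge⇒step′ r s , edge⇒step r s ]′)

  step⇒one : ∀ s r → proj₂ r ≤ p → Step s r → biadjacency s r ≡ 1ℤ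
  step⇒one s r a≤p = indicator-yes (adjacent? (even s) (odd r)) ∘ step⇒adjacent r s a≤p

  biadjacency-split : ∀ s r → proj₂ r ≤ p → biadjacency s r ≡
    indicator (s ≟ᵖ r) ℤ.+ (indicator (right s ≟ᵖ r) ℤ.+ indicator (down s ≟ᵖ r))
  biadjacency-split s r a≤p = indicator-split (s ≟ᵖ r) (right s ≟ᵖ r) (down s ≟ᵖ r)
    (λ { refl → ℕ.1+n≢n ∘ cong proj₂ })
    (λ { refl → ℕ.1+n≢n ∘ cong proj₁ })
    (λ { refl → ℕ.1+n≢n ∘ cong proj₁ })
    (step⇒one s r a≤p) (¬step⇒zero s r)

  -- The list `first ∷ odds` is the whole grid, which contains the left and upper neighbours of its
  -- points because these only lower a coordinate.
  null-vector : ∀ {r} → r ∈ odds → ∑ (first ∷ odds) (λ s → signedPaths s ℤ.* biadjacency s r) ≡ 0ℤ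
  null-vector {r@(i , a)} r∈ with i≤q , a≤p ← ∈-grid⁻ (there r∈) = trans
    (∑-split signedPaths (hits id) (hits right) (hits down) (first ∷ odds) λ s → biadjacency-split s r a≤p)
    (signedPaths-null grid-unique r (there r∈) (∈-odds⁻ r∈)
      (λ { {_ , _} refl → ∈-grid⁺ i≤q (ℕ.<⇒≤ a≤p) })
      (λ { {_ , _} refl → ∈-grid⁺ (ℕ.<⇒≤ i≤q) a≤p }))
    where
    hits : (Point → Point) → Point → ℤ
    hits g s = indicator (g s ≟ᵖ r)

  -- Both `right` and `down` move forward in the lexicographic order; this is the triangularity of
  -- `T`.
  step⇒⊀ : ∀ {s r} → Step s r → ¬ (r ≺ s)
  step⇒⊀ (inj₁ refl)        r≺s                = ≺⇒≢ r≺s refl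
  step⇒⊀ (inj₂ (inj₁ refl)) (inj₁ i<i)         = ℕ.<-irrefl refl i<i
  step⇒⊀ (inj₂ (inj₁ refl)) (inj₂ (_ , 1+a<a)) = ℕ.<-asym 1+a<a (ℕ.n<1+n _)
  step⇒⊀ (inj₂ (inj₂ refl)) (inj₁ 1+i<i)       = ℕ.<-asym 1+i<i (ℕ.n<1+n _)
  step⇒⊀ (inj₂ (inj₂ refl)) (inj₂ (eq , _))    = ℕ.1+n≢n eq

  -- Exchanging the row `first` for `last` turns the list of rows into `odds`, which is also the
  -- list of columns, and the matrix becomes unitriangular.
  det-biadjacency : detL biadjacency evens odds ≡ ℤ.- (signedPaths last ℤ.* (sgn (length middle) ℤ.* 1ℤ))
  det-biadjacency = begin
    detL biadjacency evens odds
      ≡⟨ detL-exchange biadjacency signedPaths first middle last odds refl (All.tabulate null-vector) ⟩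
    ℤ.- (signedPaths last ℤ.* (sgn (length middle) ℤ.* detL biadjacency odds odds))
      ≡⟨ cong (λ u → ℤ.- (signedPaths last ℤ.* (sgn (length middle) ℤ.* u)))
           (detL-unitriangular biadjacency odds
             (All.tabulate λ {r} r∈ → step⇒one r r (proj₂ (∈-grid⁻ (there r∈))) (inj₁ refl))
             (AllPairs.map (λ {r} {s} r≺s → ¬step⇒zero s r λ step → step⇒⊀ step r≺s)
               (AllPairs.tail grid-sorted))) ⟩
    ℤ.- (signedPaths last ℤ.* (sgn (length middle) ℤ.* 1ℤ)) ∎

  det-biadjacency-square :
    detL biadjacency evens odds ℤ.* detL biadjacency evens odds ≡ (+ ((q + p) C q)) ℤ.^ 2
  det-biadjacency-square = begin
    detL biadjacency evens odds ℤ.* detL biadjacency evens odds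
      ≡⟨ cong (λ d → d ℤ.* d) (trans det-biadjacency
           (cong (λ c → ℤ.- (c ℤ.* (t ℤ.* 1ℤ))) (signedPaths-binomial q p))) ⟩
    ℤ.- (s ℤ.* b ℤ.* (t ℤ.* 1ℤ)) ℤ.* ℤ.- (s ℤ.* b ℤ.* (t ℤ.* 1ℤ))
      ≡⟨ shuffle s t b ⟩
    s ℤ.* s ℤ.* (t ℤ.* t) ℤ.* (b ℤ.* (b ℤ.* 1ℤ))
      ≡⟨ cong₂ (λ u v → u ℤ.* v ℤ.* (b ℤ.* (b ℤ.* 1ℤ)))
           (sgn-square (q + p)) (sgn-square (length middle)) ⟩
    1ℤ ℤ.* 1ℤ ℤ.* (b ℤ.* (b ℤ.* 1ℤ))
      ≡⟨ ℤ.*-identityˡ _ ⟩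
    b ℤ.* (b ℤ.* 1ℤ) ∎
    where
    s = sgn (q + p)
    t = sgn (length middle)
    b = + ((q + p) C q)
    shuffle : ∀ s t b → ℤ.- (s ℤ.* b ℤ.* (t ℤ.* 1ℤ)) ℤ.* ℤ.- (s ℤ.* b ℤ.* (t ℤ.* 1ℤ)) ≡
                        s ℤ.* s ℤ.* (t ℤ.* t) ℤ.* (b ℤ.* (b ℤ.* 1ℤ))
    shuffle = solve-∀

  -- Colour class by colour class, the order that `detL-bipartite` works with.
  labels : List (ℕ × ℕ)
  labels = map odd odds ++ map even evens

  det-labels : detL adjacency labels labels ≡
    sgn (p * q + q + p) ℤ.* (+ ((q + p) C q)) ℤ.^ 2
  det-labels = begin
    detL adjacency labels labels
      ≡⟨ detL-bipartite adjacency (map odd odds) (map even evens)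
           (trans (List.length-map odd odds) (trans length-odds (sym (List.length-map even evens))))
           (λ {x} {y} → adjacency-sym {x} {y})
           (All.map⁺ (All.universal (λ r → All.map⁺ (All.universal (adjacency-odd-odd r) odds)) odds)) ⟩
    sgn (length (map odd odds)) ℤ.* (D ℤ.* D)
      ≡⟨ cong₂ (λ m d → sgn m ℤ.* (d ℤ.* d))
           (trans (List.length-map odd odds) (trans length-odds length-evens))
           (detL-map adjacency even odd evens odds) ⟩
    sgn (p * q + q + p) ℤ.* (detL biadjacency evens odds ℤ.* detL biadjacency evens odds)
      ≡⟨ cong (sgn (p * q + q + p) ℤ.*_) det-biadjacency-square ⟩
    sgn (p * q + q + p) ℤ.* (+ ((q + p) C q)) ℤ.^ 2 ∎
    where D = detL adjacency (map even evens) (map odd odds)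

  -- Matching labels with vertices

  long≡ : 2 * p + 2 ≡ 2 * suc p
  long≡ = trans (2*j+2 p) (sym (2*suc p))

  row-vertex : ∀ {i m} → i < q → m < 2 * p + 2 → ∃[ v ] label v ≡ (suc i , suc m)
  row-vertex i<q m<2p+2 = inj₁ (fromℕ< i<q , fromℕ< m<2p+2) ,
    cong₂ (λ i m → suc i , suc m) (toℕ-fromℕ< i<q) (toℕ-fromℕ< m<2p+2)

  last-row-vertex : ∀ {m} → m < 2 * p → ∃[ v ] label v ≡ (suc q , 2 + m)
  last-row-vertex m<2p = inj₂ (fromℕ< m<2p) , cong (λ m → suc q , 2 + m) (toℕ-fromℕ< m<2p)

  2a<2p+2 : ∀ {a} → a ≤ p → suc (2 * a) < 2 * p + 2
  2a<2p+2 {a} a≤p = subst (suc (suc (2 * a)) ≤_) (sym (2*j+2 p)) (s≤s (s≤s (ℕ.*-monoʳ-≤ 2 a≤p)))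

  2a+1<2p : ∀ {a} → a < p → suc (2 * a) < 2 * p
  2a+1<2p {a} a<p = subst (_≤ 2 * p) (2*suc a) (ℕ.*-monoʳ-≤ 2 a<p)

  odd-vertex : ∀ r → proj₁ r ≤ q → proj₂ r ≤ p → r ≢ first → ∃[ v ] label v ≡ odd r
  odd-vertex (zero  , zero)  _   _   r≢ = contradiction refl r≢
  odd-vertex (suc i , zero)  i<q a≤p _  = row-vertex i<q (ℕ.<⇒≤ (2a<2p+2 {0} a≤p))
  odd-vertex (i     , suc a) i≤q a<p _ with ℕ.m≤n⇒m<n∨m≡n i≤q
  ... | inj₁ i<q  = row-vertex i<q (ℕ.<⇒≤ (2a<2p+2 a<p))
  -- The last path starts at subscript 2, so subscript `2a + 3` has index `2a + 1`.
  ... | inj₂ refl with v , eq ← last-row-vertex (2a+1<2p a<p) =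
    v , trans eq (cong (λ m → suc q , suc m) (sym (2*suc a)))

  even-vertex : ∀ r → proj₁ r ≤ q → proj₂ r ≤ p → r ≢ last → ∃[ v ] label v ≡ even r
  even-vertex (i , a) i≤q a≤p r≢ with ℕ.m≤n⇒m<n∨m≡n i≤q
  ... | inj₁ i<q  = row-vertex i<q (2a<2p+2 a≤p)
  -- The index is `2a`; excluding `last` gives `a < p`, as the last path ends at subscript `2p + 1`.
  ... | inj₂ refl = last-row-vertex (ℕ.<⇒≤ (2a+1<2p (ℕ.≤∧≢⇒< a≤p (r≢ ∘ cong (q ,_)))))

  label-surjective : ∀ {x} → x ∈ labels → ∃[ v ] label v ≡ x
  label-surjective x∈ with ∈-++⁻ (map odd odds) x∈
  ... | inj₁ x∈odd with r , r∈ , refl ← ∈-map⁻ odd x∈odd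
                   with i≤q , a≤p ← ∈-grid⁻ (there r∈) = odd-vertex r i≤q a≤p (∈-odds⁻ r∈)
  ... | inj₂ x∈even with r , r∈ , refl ← ∈-map⁻ even {xs = evens} x∈even
                    with i≤q , a≤p ← ∈-grid⁻ (∈-++⁺ˡ {ys = [ last ]} r∈) =
    even-vertex r i≤q a≤p (∈-evens⁻ r∈)

  odd∈labels : ∀ {r} → proj₁ r ≤ q → proj₂ r ≤ p → r ≢ first → odd r ∈ labels
  odd∈labels i≤q a≤p r≢ = ∈-++⁺ˡ (∈-map⁺ odd (∈-odds⁺ (∈-grid⁺ i≤q a≤p) r≢))

  even∈labels : ∀ {r} → proj₁ r ≤ q → proj₂ r ≤ p → r ≢ last → even r ∈ labels
  even∈labels i≤q a≤p r≢ = ∈-++⁺ʳ (map odd odds) (∈-map⁺ even (∈-evens⁺ (∈-grid⁺ i≤q a≤p) r≢))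

  row-label∈labels : ∀ {i} m → i < q → m < 2 * p + 2 → (suc i , suc m) ∈ labels
  row-label∈labels m i<q m< with halve m
  -- The first vertex of a path lies one grid row below the rest of that path.
  ... | zero  , inj₁ refl = odd∈labels {suc _ , zero} i<q z≤n λ ()
  ... | suc a , inj₁ refl = odd∈labels {_ , suc a} (ℕ.<⇒≤ i<q)
    (ℕ.≤-pred (ℕ.*-cancelˡ-< 2 (suc a) (suc p) (subst (2 * suc a <_) long≡ m<))) λ ()
  ... | a , inj₂ refl = even∈labels {_ , a} (ℕ.<⇒≤ i<q)
    (ℕ.≤-pred (ℕ.*-cancelˡ-< 2 a (suc p) (subst (2 * a <_) long≡ (ℕ.<⇒≤ m<))))
    λ eq → ℕ.<⇒≢ i<q (cong proj₁ eq)

  last-row-label∈labels : ∀ m → m < 2 * p → (suc q , 2 + m) ∈ labels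
  last-row-label∈labels m m< with halve m
  ... | a , inj₁ refl with a<p ← ℕ.*-cancelˡ-< 2 a p m< =
    even∈labels {q , a} ℕ.≤-refl (ℕ.<⇒≤ a<p) λ eq → ℕ.<⇒≢ a<p (cong proj₂ eq)
  ... | a , inj₂ refl = subst (_∈ labels) (cong (λ m → suc q , suc m) (2*suc a))
    (odd∈labels {q , suc a} ℕ.≤-refl (ℕ.*-cancelˡ-< 2 a p (ℕ.<⇒≤ m<)) λ ())

  label∈labels : ∀ v → label v ∈ labels
  label∈labels (inj₁ (i , j)) = row-label∈labels (toℕ j) (toℕ<n i) (toℕ<n j)
  label∈labels (inj₂ j)       = last-row-label∈labels (toℕ j) (toℕ<n j)

  label-injective : ∀ {u v} → label u ≡ label v → u ≡ v
  label-injective {inj₁ (i , j)} {inj₁ (i′ , j′)} eq = cong₂ (λ i j → inj₁ (i , j))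
    (toℕ-injective (ℕ.suc-injective (cong proj₁ eq)))
    (toℕ-injective (ℕ.suc-injective (cong proj₂ eq)))
  label-injective {inj₁ (i , _)} {inj₂ _} eq =
    contradiction (ℕ.suc-injective (cong proj₁ eq)) (ℕ.<⇒≢ (toℕ<n i))
  label-injective {inj₂ _} {inj₁ (i , _)} eq =
    contradiction (sym (ℕ.suc-injective (cong proj₁ eq))) (ℕ.<⇒≢ (toℕ<n i))
  label-injective {inj₂ j} {inj₂ j′} eq =
    cong inj₂ (toℕ-injective (ℕ.suc-injective (ℕ.suc-injective (cong proj₂ eq))))

  labels-unique : Unique labels
  labels-unique = Unique.++⁺
    (Unique.map⁺ odd-injective (AllPairs.tail grid-unique))
    (Unique.map⁺ even-injective (Unique-++⁻ˡ evens grid-unique))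
    disjoint
    where
    disjoint : ∀ {x} → ¬ (x ∈ map odd odds × x ∈ map even evens)
    disjoint (x∈odd , x∈even)
      with r , _ , refl ← ∈-map⁻ odd x∈odd
      with s , _ , eq ← ∈-map⁻ even {xs = evens} x∈even = odd≢even r s eq

  -- Both lists are free of repetitions and have the same members, so they agree up to order.
  enumeration↭labels : ∀ {N} (vertices : Fin N ↔ Vertex) →
    tabulate (label ∘ Inverse.to vertices) ↭ labels
  enumeration↭labels vertices = ∼bag⇒↭ (unique∧set⇒bag
    (Unique.tabulate⁺ (to-injective ∘ label-injective))
    labels-unique
    (mk⇔ listed enumerated))
    where
    open Inverse vertices

    to-injective : ∀ {i j} → to i ≡ to j → i ≡ j
    to-injective {i} {j} eq =
      trans (sym (strictlyInverseʳ i)) (trans (cong from eq) (strictlyInverseʳ j))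

    listed : ∀ {x} → x ∈ tabulate (label ∘ to) → x ∈ labels
    listed x∈ with i , refl ← ∈-tabulate⁻ x∈ = label∈labels (to i)

    enumerated : ∀ {x} → x ∈ labels → x ∈ tabulate (label ∘ to)
    enumerated x∈ with v , refl ← label-surjective x∈ =
      subst (λ u → label u ∈ tabulate (label ∘ to)) (strictlyInverseˡ v) (∈-tabulate⁺ (from v))

theorem3 : ∀ (k n : ℕ) → 1 ≤ k → 1 ≤ n →
    ∀ {N : ℕ} (vertices : Fin N ↔ SimpleGraph.V (H k n)) →
    det (A (H k n) vertices) ≡ (-1ℤ ℤ.^ (k * n + n + k)) ℤ.* ((+ ((n + k) C n)) ℤ.^ 2)
theorem3 k (suc n′) _ _ vertices = begin
  det (A (H k (suc n′)) vertices)
    -- `A` sees vertices only through their labels, so its entries are by definition those of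
    -- `adjacency` at `label ∘ to`.
    ≡⟨ det≡detL adjacency (label ∘ to) (label ∘ to) ⟩
  detL adjacency (tabulate (label ∘ to)) (tabulate (label ∘ to))
    ≡⟨ detL-relabel adjacency (enumeration↭labels vertices) ⟩
  detL adjacency labels labels
    ≡⟨ det-labels ⟩
  sgn (k * suc n′ + suc n′ + k) ℤ.* (+ ((suc n′ + k) C suc n′)) ℤ.^ 2 ∎
  where
  open Hexagonal k (suc n′)
  open Grid k n′
  open Inverse vertices using (to)
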